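{- (i) For any $\Gamma\cup\{A\}\subseteq\mathcal{L}_\infty$, if $\Gamma\vdash_{\mathbf{GL}_h}A$ then $\Gamma^f\vdash_{\mathbf{GL}}A^f$. (ii) For any set $\Gamma\cup\{A\}$ of formulas of the ordinary unimodal language $\mathcal{L}_\Box$ and any witnesses $v$ for $\Gamma$ and $w$ for $A$, if $\Gamma\vdash_{\mathbf{GL}}A$ then $\Gamma(v)\vdash_{\mathbf{GL}_h}A(w)$.
   Context: The language $\mathcal{L}_\infty$ consists of modal formulas built from propositional atoms, $\bot,\top$, the connectives $\neg,\wedge,\vee,\rightarrow$ and unary modalities $\Box_n$ ($n\in\mathbb{N}$), with the restriction that $\Box_n A$ is a formula only if $n$ is strictly greater than the index of every box occurring in $A$. Axiom instances are only those that are $\mathcal{L}_\infty$-formulas. Axiom schemes (for all $n\ge0$): $\mathbf{H}$: $\Box_n A\rightarrow\Box_{n+1}A$; $\mathbf{K}_h$: $\Box_n(A\rightarrow B)\rightarrow(\Box_nA\rightarrow\Box_nB)$; $\mathbf{4}_h$: $\Box_nA\rightarrow\Box_{n+1}\Box_nA$; $\mathbf{L}_h$: $\Box_{n+1}(\Box_nA\rightarrow A)\rightarrow\Box_nA$. $\mathbf{GL}_h$ is the least set of $\mathcal{L}_\infty$-formulas containing all classical propositional tautologies and all instances of $\mathbf{H},\mathbf{K}_h,\mathbf{4}_h,\mathbf{L}_h$, closed under modus ponens and the rule: from $A$ infer $\Box_nA$ for any $n$ greater than all box indices in $A$. $\mathbf{GL}$ is the usual Gödel–Löb provability logic in $\mathcal{L}_\Box$,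 the usual modal language with one modality $\Box$. For a logic $L$ and a set $\Gamma$, $\Gamma\vdash_LA$ means $\bigwedge\Delta\rightarrow A\in L$ for some finite $\Delta\subseteq\Gamma$. The forgetful translation $f:\mathcal{L}_\infty\to\mathcal{L}_\Box$ fixes atoms, commutes with the connectives and sends every $\Box_n$ to $\Box$; $\Gamma^f=\{B^f:B\in\Gamma\}$. A witness for $A\in\mathcal{L}_\Box$ is an assignment of a natural number to each occurrence of $\Box$ in $A$ such that the number assigned to each occurrence is strictly greater than the numbers assigned to all box occurrences inside its scope. For a witness $w$ of $A$, $A(w)\in\mathcal{L}_\infty$ is obtained by replacing each occurrence of $\Box$ by $\Box_n$ with $n$ its assigned number. A witness $v$ for a set $\Gamma$ is a family assigning a witness $v_B$ to each $B\in\Gamma$, and $\Gamma(v)=\{B(v_B):B\in\Gamma\}$. -}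

module Defs where

open import Data.Bool as Bool using (Bool; true; false; not)
open import Data.List using (List; []; _∷_; _++_; foldr)
open import Data.List.Relation.Unary.All using (All; []; _∷_)
open import Data.List.Relation.Unary.All.Properties using (++⁺)
open import Data.Nat using (ℕ; suc; _<_)
open import Data.Product using (∃-syntax; _×_)
open import Function using (_∘_)
open import Level using (Level; 0ℓ)
open import Relation.Binary.PropositionalEquality using (_≡_)
open import Relation.Unary using (Pred; _∈_)

infix  9 ∼_ □_
infixr 7 _∧_
infixr 6 _∨_
infixr 5 _⇒_

data Form□ : Set where
  atom        : ℕ → Form□
  ⊥ ⊤         : Form□
  ∼_          : Form□ → Form□
  _∧_ _∨_ _⇒_ : Form□ → Form□ → Form□
  □_          : Form□ → Form□

-- In □ₙ n A p, the bound p says that n exceeds the index of every box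
-- occurring in A.  It is irrelevant, so that formulas are identified exactly
-- when they agree as strings.
mutual
  data Form∞ : Set where
    atom        : ℕ → Form∞
    ⊥ ⊤         : Form∞
    ∼_          : Form∞ → Form∞
    _∧_ _∨_ _⇒_ : Form∞ → Form∞ → Form∞
    □ₙ          : (n : ℕ) (A : Form∞) → .(All (_< n) (indices A)) → Form∞

  indices : Form∞ → List ℕ
  indices (atom _)   = []
  indices ⊥          = []
  indices ⊤          = []
  indices (∼ A)      = indices A
  indices (A ∧ B)    = indices A ++ indices B
  indices (A ∨ B)    = indices A ++ indices B
  indices (A ⇒ B)    = indices A ++ indices B
  indices (□ₙ n A _) = n ∷ indices A

_exceeds_ : ℕ → Form∞ → Set
n exceeds A = All (_< n) (indices A)

-- Boxed formulas are propositionally atomic: the valuation v is consulted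
-- only at atoms and at boxed formulas.
eval□ : (Form□ → Bool) → Form□ → Bool
eval□ v (atom p) = v (atom p)
eval□ v ⊥        = false
eval□ v ⊤        = true
eval□ v (∼ A)    = not (eval□ v A)
eval□ v (A ∧ B)  = eval□ v A Bool.∧ eval□ v B
eval□ v (A ∨ B)  = eval□ v A Bool.∨ eval□ v B
eval□ v (A ⇒ B)  = not (eval□ v A) Bool.∨ eval□ v B
eval□ v (□ A)    = v (□ A)

eval∞ : (Form∞ → Bool) → Form∞ → Bool
eval∞ v (atom p)   = v (atom p)
eval∞ v ⊥          = false
eval∞ v ⊤          = true
eval∞ v (∼ A)      = not (eval∞ v A)
eval∞ v (A ∧ B)    = eval∞ v A Bool.∧ eval∞ v B
eval∞ v (A ∨ B)    = eval∞ v A Bool.∨ eval∞ v B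
eval∞ v (A ⇒ B)    = not (eval∞ v A) Bool.∨ eval∞ v B
eval∞ v (□ₙ n A p) = v (□ₙ n A p)

Tautology□ : Pred Form□ 0ℓ
Tautology□ A = ∀ v → eval□ v A ≡ true

Tautology∞ : Pred Form∞ 0ℓ
Tautology∞ A = ∀ v → eval∞ v A ≡ true

-- The scheme □ A ⇒ □ □ A is derivable from K and L.
data GL : Pred Form□ 0ℓ where
  taut : ∀ {A} → Tautology□ A → GL A
  K    : ∀ A B → GL (□ (A ⇒ B) ⇒ (□ A ⇒ □ B))
  L    : ∀ A → GL (□ (□ A ⇒ A) ⇒ □ A)
  mp   : ∀ {A B} → GL (A ⇒ B) → GL A → GL B
  nec  : ∀ {A} → GL A → GL (□ A)

-- The bounds quantified over in each scheme restrict it to the instances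
-- that are formulas of the language.
data GLₕ : Pred Form∞ 0ℓ where
  taut : ∀ {A} → Tautology∞ A → GLₕ A
  H    : ∀ n A .(p : n exceeds A) .(q : suc n exceeds A) →
         GLₕ (□ₙ n A p ⇒ □ₙ (suc n) A q)
  Kₕ   : ∀ n A B .(p : n exceeds (A ⇒ B)) .(q : n exceeds A) .(r : n exceeds B) →
         GLₕ (□ₙ n (A ⇒ B) p ⇒ (□ₙ n A q ⇒ □ₙ n B r))
  4ₕ   : ∀ n A .(p : n exceeds A) .(q : suc n exceeds (□ₙ n A p)) →
         GLₕ (□ₙ n A p ⇒ □ₙ (suc n) (□ₙ n A p) q)
  Lₕ   : ∀ n A .(p : n exceeds A) .(q : suc n exceeds (□ₙ n A p ⇒ A)) →
         GLₕ (□ₙ (suc n) (□ₙ n A p ⇒ A) q ⇒ □ₙ n A p)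
  mp   : ∀ {A B} → GLₕ (A ⇒ B) → GLₕ A → GLₕ B
  nec  : ∀ {A} n .(p : n exceeds A) → GLₕ A → GLₕ (□ₙ n A p)

-- Finite subsets of Γ are given by lists of elements of Γ.
module Consequence {F : Set} (true′ : F) (_and_ _implies_ : F → F → F) where

  ⋀ : List F → F
  ⋀ = foldr _and_ true′

  infix 3 _⊢[_]_
  _⊢[_]_ : ∀ {ℓ : Level} → Pred F ℓ → Pred F 0ℓ → F → Set ℓ
  Γ ⊢[ Λ ] A = ∃[ Δ ] (All (_∈ Γ) Δ × (⋀ Δ implies A) ∈ Λ)

open Consequence {Form□} ⊤ _∧_ _⇒_ public
  renaming (⋀ to ⋀□; _⊢[_]_ to _⊢□[_]_)
open Consequence {Form∞} ⊤ _∧_ _⇒_ public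
  renaming (⋀ to ⋀∞; _⊢[_]_ to _⊢∞[_]_)

infix 20 _ᶠ
_ᶠ : Form∞ → Form□
(atom p) ᶠ   = atom p
⊥ ᶠ          = ⊥
⊤ ᶠ          = ⊤
(∼ A) ᶠ      = ∼ (A ᶠ)
(A ∧ B) ᶠ    = A ᶠ ∧ B ᶠ
(A ∨ B) ᶠ    = A ᶠ ∨ B ᶠ
(A ⇒ B) ᶠ    = A ᶠ ⇒ B ᶠ
(□ₙ _ A _) ᶠ = □ (A ᶠ)

infix 20 _ᶠˢ
_ᶠˢ : ∀ {ℓ : Level} → Pred Form∞ ℓ → Pred Form□ ℓ
(Γ ᶠˢ) C = ∃[ B ] (B ∈ Γ × C ≡ B ᶠ)

-- Occ A is the type of occurrences of □ in A.
data Occ : Form□ → Set where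
  here  : ∀ {A} → Occ (□ A)
  under : ∀ {A} → Occ A → Occ (□ A)
  neg   : ∀ {A} → Occ A → Occ (∼ A)
  ∧ˡ    : ∀ {A B} → Occ A → Occ (A ∧ B)
  ∧ʳ    : ∀ {A B} → Occ B → Occ (A ∧ B)
  ∨ˡ    : ∀ {A B} → Occ A → Occ (A ∨ B)
  ∨ʳ    : ∀ {A B} → Occ B → Occ (A ∨ B)
  ⇒ˡ    : ∀ {A B} → Occ A → Occ (A ⇒ B)
  ⇒ʳ    : ∀ {A B} → Occ B → Occ (A ⇒ B)

-- o inScopeOf o′: the occurrence o lies (strictly) inside the scope of o′.
infix 4 _inScopeOf_
data _inScopeOf_ : ∀ {A} → Occ A → Occ A → Set where
  here  : ∀ {A} {o : Occ A} → under o inScopeOf here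
  under : ∀ {A} {o o′ : Occ A} → o inScopeOf o′ → under o inScopeOf under o′
  neg   : ∀ {A} {o o′ : Occ A} → o inScopeOf o′ → neg o inScopeOf neg o′
  ∧ˡ    : ∀ {A B} {o o′ : Occ A} → o inScopeOf o′ → ∧ˡ {A} {B} o inScopeOf ∧ˡ o′
  ∧ʳ    : ∀ {A B} {o o′ : Occ B} → o inScopeOf o′ → ∧ʳ {A} {B} o inScopeOf ∧ʳ o′
  ∨ˡ    : ∀ {A B} {o o′ : Occ A} → o inScopeOf o′ → ∨ˡ {A} {B} o inScopeOf ∨ˡ o′
  ∨ʳ    : ∀ {A B} {o o′ : Occ B} → o inScopeOf o′ → ∨ʳ {A} {B} o inScopeOf ∨ʳ o′
  ⇒ˡ    : ∀ {A B} {o o′ : Occ A} → o inScopeOf o′ → ⇒ˡ {A} {B} o inScopeOf ⇒ˡ o′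
  ⇒ʳ    : ∀ {A B} {o o′ : Occ B} → o inScopeOf o′ → ⇒ʳ {A} {B} o inScopeOf ⇒ʳ o′

record Witness (A : Form□) : Set where
  constructor witness
  field
    label   : Occ A → ℕ
    nesting : ∀ {o o′} → o inScopeOf o′ → label o < label o′

open Witness public

restrict : ∀ {A B} (ι : Occ A → Occ B) →
           (∀ {o o′} → o inScopeOf o′ → ι o inScopeOf ι o′) →
           Witness B → Witness A
restrict ι ι-scope w = witness (label w ∘ ι) (λ s → nesting w (ι-scope s))

infix 20 _⟨_⟩
mutual
  _⟨_⟩ : (A : Form□) → Witness A → Form∞
  atom p  ⟨ w ⟩ = atom p
  ⊥       ⟨ w ⟩ = ⊥
  ⊤       ⟨ w ⟩ = ⊤
  (∼ A)   ⟨ w ⟩ = ∼ (A ⟨ restrict neg neg w ⟩)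
  (A ∧ B) ⟨ w ⟩ = A ⟨ restrict ∧ˡ ∧ˡ w ⟩ ∧ B ⟨ restrict ∧ʳ ∧ʳ w ⟩
  (A ∨ B) ⟨ w ⟩ = A ⟨ restrict ∨ˡ ∨ˡ w ⟩ ∨ B ⟨ restrict ∨ʳ ∨ʳ w ⟩
  (A ⇒ B) ⟨ w ⟩ = A ⟨ restrict ⇒ˡ ⇒ˡ w ⟩ ⇒ B ⟨ restrict ⇒ʳ ⇒ʳ w ⟩
  (□ A)   ⟨ w ⟩ = □ₙ (label w here) (A ⟨ restrict under under w ⟩)
                    (⟨⟩-bound A (restrict under under w) (λ o → nesting w here))

  ⟨⟩-bound : ∀ A (w : Witness A) {n} → (∀ o → label w o < n) → n exceeds (A ⟨ w ⟩)
  ⟨⟩-bound (atom p) w b = []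
  ⟨⟩-bound ⊥        w b = []
  ⟨⟩-bound ⊤        w b = []
  ⟨⟩-bound (∼ A)    w b = ⟨⟩-bound A _ (b ∘ neg)
  ⟨⟩-bound (A ∧ B)  w b = ++⁺ (⟨⟩-bound A _ (b ∘ ∧ˡ)) (⟨⟩-bound B _ (b ∘ ∧ʳ))
  ⟨⟩-bound (A ∨ B)  w b = ++⁺ (⟨⟩-bound A _ (b ∘ ∨ˡ)) (⟨⟩-bound B _ (b ∘ ∨ʳ))
  ⟨⟩-bound (A ⇒ B)  w b = ++⁺ (⟨⟩-bound A _ (b ∘ ⇒ˡ)) (⟨⟩-bound B _ (b ∘ ⇒ʳ))
  ⟨⟩-bound (□ A)    w b = b here ∷ ⟨⟩-bound A _ (b ∘ under)

-- The membership proof is irrelevant, so that the family assigns exactly one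
-- witness to each B ∈ Γ.
Witnessˢ : ∀ {ℓ : Level} → Pred Form□ ℓ → Set ℓ
Witnessˢ Γ = (B : Form□) → .(B ∈ Γ) → Witness B

infix 20 _⟨_⟩ˢ
_⟨_⟩ˢ : ∀ {ℓ : Level} (Γ : Pred Form□ ℓ) → Witnessˢ Γ → Pred Form∞ ℓ
(Γ ⟨ v ⟩ˢ) C = ∃[ B ] ∃[ B∈Γ ] C ≡ B ⟨ v B B∈Γ ⟩

{-# OPTIONS --safe #-}
-- The schemes H and Lₕ make all admissible boxes over one formula equivalent:
-- from □ₙ₊₁ A one gets □ₙ₊₁ (□ₙ A ⇒ A), hence □ₙ A.  So up to provable
-- equivalence an ℒ∞-formula depends only on its forgetful image, and a
-- GL-derivation may be replayed in GLₕ with the least admissible index on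
-- every box.  Conversely, the forgetful image of every GLₕ-axiom is provable
-- in GL.
module Submission where

open import Defs
open import Data.Bool as Bool using (Bool; true; false; not; T)
open import Data.Bool.Properties using (T-≡; T-∧)
open import Data.List using ([]; _∷_; map)
open import Data.List.Extrema.Nat using (max; xs≤max)
open import Data.List.Relation.Unary.All as All using (All; []; _∷_)
open import Data.List.Relation.Unary.All.Properties using (++⁺; ++⁻ˡ; ++⁻ʳ)
open import Data.Nat using (ℕ; zero; suc; _≤_; _≤′_; ≤′-refl; ≤′-step; s≤s; _⊔_)
open import Data.Nat.Properties
  using (≤⇒≤′; ≤′⇒≤; ≤-trans; n<1+n; n≤1+n; m≤m⊔n; m≤n⊔m)
open import Data.Product using (_×_; _,_; ∃-syntax; proj₁; proj₂)
open import Function using (_∘_)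
open import Function.Bundles using (Equivalence)
open import Level using (Level)
open import Relation.Binary.PropositionalEquality
  using (_≡_; refl; sym; trans; cong; cong₂; subst)
open import Relation.Unary using (Pred; _∈_)

-- Propositional tautologies by truth tables

infixr 4 _⊃_
_⊃_ : Bool → Bool → Bool
a ⊃ b = not a Bool.∨ b

BoolFun : ℕ → Set
BoolFun zero    = Bool
BoolFun (suc n) = Bool → BoolFun n

valid : ∀ n → BoolFun n → Bool
valid zero    b = b
valid (suc n) f = valid n (f false) Bool.∧ valid n (f true)

Valid : ∀ n → BoolFun n → Set
Valid zero    b = b ≡ true
Valid (suc n) f = ∀ b → Valid n (f b)

-- For a concrete `f` with a true table the hidden argument computes to the unit type and is filled
-- in automatically, so each propositional step below is checked by evaluating all rows.
truthTable : ∀ n (f : BoolFun n) {_ : T (valid n f)} → Valid n f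
truthTable zero    b {t} = Equivalence.to T-≡ t
truthTable (suc n) f {t} false = truthTable n (f false) {proj₁ (Equivalence.to T-∧ t)}
truthTable (suc n) f {t} true  = truthTable n (f true)
  {proj₂ (Equivalence.to (T-∧ {valid n (f false)}) t)}

private
  variable
    A B C : Form□
    X X′ Y Y′ Z : Form∞
    m n : ℕ

-- Forgetting indices preserves provability

-- Boxed formulas count as atoms in both languages, so `v ∘ _ᶠ` is again a valuation and tautologies
-- survive forgetting.
eval-ᶠ : ∀ v X → eval□ v (X ᶠ) ≡ eval∞ (v ∘ _ᶠ) X
eval-ᶠ v (atom p)   = refl
eval-ᶠ v ⊥          = refl
eval-ᶠ v ⊤          = refl
eval-ᶠ v (∼ X)      = cong not (eval-ᶠ v X)
eval-ᶠ v (X ∧ Y)    = cong₂ Bool._∧_ (eval-ᶠ v X) (eval-ᶠ v Y)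
eval-ᶠ v (X ∨ Y)    = cong₂ Bool._∨_ (eval-ᶠ v X) (eval-ᶠ v Y)
eval-ᶠ v (X ⇒ Y)    = cong₂ _⊃_ (eval-ᶠ v X) (eval-ᶠ v Y)
eval-ᶠ v (□ₙ n X p) = refl

GL-refl : ∀ A → GL (A ⇒ A)
GL-refl A = taut λ v → truthTable 1 (λ a → a ⊃ a) (eval□ v A)

GL-trans : GL (A ⇒ B) → GL (B ⇒ C) → GL (A ⇒ C)
GL-trans {A} {B} {C} d e = mp (mp (taut λ v →
  truthTable 3 (λ a b c → (a ⊃ b) ⊃ (b ⊃ c) ⊃ a ⊃ c)
    (eval□ v A) (eval□ v B) (eval□ v C)) d) e

GL-□-mono : GL (A ⇒ B) → GL (□ A ⇒ □ B)
GL-□-mono {A} {B} d = mp (K A B) (nec d)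

-- Löb's axiom is applied to □ A ∧ A.
GL-4 : ∀ A → GL (□ A ⇒ □ □ A)
GL-4 A = GL-trans (GL-□-mono premise) (GL-trans (L D) (GL-□-mono ∧-elimˡ))
  where
  D : Form□
  D = □ A ∧ A

  ∧-elimˡ : GL (D ⇒ □ A)
  ∧-elimˡ = taut λ v →
    truthTable 2 (λ p a → p Bool.∧ a ⊃ p) (eval□ v (□ A)) (eval□ v A)

  ∧-elimʳ : GL (D ⇒ A)
  ∧-elimʳ = taut λ v →
    truthTable 2 (λ p a → p Bool.∧ a ⊃ a) (eval□ v (□ A)) (eval□ v A)

  premise : GL (A ⇒ (□ D ⇒ D))
  premise = mp (taut λ v →
    truthTable 3 (λ a p q → (q ⊃ p) ⊃ a ⊃ q ⊃ p Bool.∧ a)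
      (eval□ v A) (eval□ v (□ A)) (eval□ v (□ D))) (GL-□-mono ∧-elimʳ)

GLₕ⇒GL : GLₕ X → GL (X ᶠ)
GLₕ⇒GL {X} (taut t)     = taut λ v → trans (eval-ᶠ v X) (t (v ∘ _ᶠ))
GLₕ⇒GL (H n X p q)      = GL-refl (□ (X ᶠ))
GLₕ⇒GL (Kₕ n X Y p q r) = K (X ᶠ) (Y ᶠ)
GLₕ⇒GL (4ₕ n X p q)     = GL-4 (X ᶠ)
GLₕ⇒GL (Lₕ n X p q)     = L (X ᶠ)
GLₕ⇒GL (mp d e)         = mp (GLₕ⇒GL d) (GLₕ⇒GL e)
GLₕ⇒GL (nec n p d)      = nec (GLₕ⇒GL d)

⋀-ᶠ : ∀ Δ → (⋀∞ Δ) ᶠ ≡ ⋀□ (map _ᶠ Δ)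
⋀-ᶠ []      = refl
⋀-ᶠ (X ∷ Δ) = cong (X ᶠ ∧_) (⋀-ᶠ Δ)

-- Index invariance of the boxes of GLₕ

GLₕ-refl : ∀ X → GLₕ (X ⇒ X)
GLₕ-refl X = taut λ v → truthTable 1 (λ a → a ⊃ a) (eval∞ v X)

GLₕ-const : ∀ X Y → GLₕ (X ⇒ (Y ⇒ X))
GLₕ-const X Y = taut λ v → truthTable 2 (λ a b → a ⊃ b ⊃ a) (eval∞ v X) (eval∞ v Y)

GLₕ-trans : GLₕ (X ⇒ Y) → GLₕ (Y ⇒ Z) → GLₕ (X ⇒ Z)
GLₕ-trans {X} {Y} {Z} d e = mp (mp (taut λ v →
  truthTable 3 (λ a b c → (a ⊃ b) ⊃ (b ⊃ c) ⊃ a ⊃ c)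
    (eval∞ v X) (eval∞ v Y) (eval∞ v Z)) d) e

GLₕ-∼-mono : GLₕ (X′ ⇒ X) → GLₕ (∼ X ⇒ ∼ X′)
GLₕ-∼-mono {X′} {X} d = mp (taut λ v →
  truthTable 2 (λ a′ a → (a′ ⊃ a) ⊃ not a ⊃ not a′) (eval∞ v X′) (eval∞ v X)) d

GLₕ-∧-mono : GLₕ (X ⇒ X′) → GLₕ (Y ⇒ Y′) → GLₕ (X ∧ Y ⇒ X′ ∧ Y′)
GLₕ-∧-mono {X} {X′} {Y} {Y′} d e = mp (mp (taut λ v →
  truthTable 4 (λ a a′ b b′ → (a ⊃ a′) ⊃ (b ⊃ b′) ⊃ a Bool.∧ b ⊃ a′ Bool.∧ b′)
    (eval∞ v X) (eval∞ v X′) (eval∞ v Y) (eval∞ v Y′)) d) e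

GLₕ-∨-mono : GLₕ (X ⇒ X′) → GLₕ (Y ⇒ Y′) → GLₕ (X ∨ Y ⇒ X′ ∨ Y′)
GLₕ-∨-mono {X} {X′} {Y} {Y′} d e = mp (mp (taut λ v →
  truthTable 4 (λ a a′ b b′ → (a ⊃ a′) ⊃ (b ⊃ b′) ⊃ a Bool.∨ b ⊃ a′ Bool.∨ b′)
    (eval∞ v X) (eval∞ v X′) (eval∞ v Y) (eval∞ v Y′)) d) e

GLₕ-⇒-mono : GLₕ (X′ ⇒ X) → GLₕ (Y ⇒ Y′) → GLₕ ((X ⇒ Y) ⇒ (X′ ⇒ Y′))
GLₕ-⇒-mono {X′} {X} {Y} {Y′} d e = mp (mp (taut λ v →
  truthTable 4 (λ a′ a b b′ → (a′ ⊃ a) ⊃ (b ⊃ b′) ⊃ (a ⊃ b) ⊃ a′ ⊃ b′)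
    (eval∞ v X′) (eval∞ v X) (eval∞ v Y) (eval∞ v Y′)) d) e

exceeds-mono : ∀ X → m ≤ n → m exceeds X → n exceeds X
exceeds-mono X m≤n = All.map (λ i<m → ≤-trans i<m m≤n)

GLₕ-□-mono-at : ∀ n .(p : n exceeds X) .(q : n exceeds Y) →
                GLₕ (X ⇒ Y) → GLₕ (□ₙ n X p ⇒ □ₙ n Y q)
GLₕ-□-mono-at {X} {Y} n p q d = mp (Kₕ n X Y (++⁺ p q) p q) (nec n (++⁺ p q) d)

□ₙ-raise : m ≤′ n → ∀ X .(p : m exceeds X) .(q : n exceeds X) →
           GLₕ (□ₙ m X p ⇒ □ₙ n X q)
□ₙ-raise ≤′-refl X p q = GLₕ-refl (□ₙ _ X p)
□ₙ-raise (≤′-step {n} m≤n) X p q =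
  GLₕ-trans (□ₙ-raise m≤n X p (exceeds-mono X (≤′⇒≤ m≤n) p)) (H n X _ q)

exceeds-reflection : ∀ n X .(p : n exceeds X) → suc n exceeds X →
                     suc n exceeds (□ₙ n X p ⇒ X)
-- The head bounds the new box itself; the two copies of `q` serve `X` under that box and `X` after
-- the arrow.
exceeds-reflection n X p q = n<1+n n ∷ ++⁺ q q

-- Converse of `H`: the boxed formula is weakened to the premise of `Lₕ`.
□ₙ-lower-suc : ∀ n X .(p : n exceeds X) .(q : suc n exceeds X) →
               GLₕ (□ₙ (suc n) X q ⇒ □ₙ n X p)
□ₙ-lower-suc n X p q = GLₕ-trans
  (GLₕ-□-mono-at (suc n) q (exceeds-reflection n X p q) (GLₕ-const X (□ₙ n X p)))
  (Lₕ n X p (exceeds-reflection n X p q))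

□ₙ-lower : m ≤′ n → ∀ X .(p : m exceeds X) .(q : n exceeds X) →
           GLₕ (□ₙ n X q ⇒ □ₙ m X p)
□ₙ-lower ≤′-refl X p q = GLₕ-refl (□ₙ _ X p)
□ₙ-lower (≤′-step {n} m≤n) X p q =
  GLₕ-trans (□ₙ-lower-suc n X (exceeds-mono X (≤′⇒≤ m≤n) p) q) (□ₙ-lower m≤n X p _)

-- The index `m ⊔ n` is admissible for both `X` and `Y`: raise to it, apply `Kₕ` there, then lower.
GLₕ-□-mono : ∀ m n .(p : m exceeds X) .(q : n exceeds Y) →
             GLₕ (X ⇒ Y) → GLₕ (□ₙ m X p ⇒ □ₙ n Y q)
GLₕ-□-mono {X} {Y} m n p q d =
  GLₕ-trans (□ₙ-raise (≤⇒≤′ (m≤m⊔n m n)) X p (exceeds-mono X (m≤m⊔n m n) p))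
  (GLₕ-trans (GLₕ-□-mono-at (m ⊔ n) _ (exceeds-mono Y (m≤n⊔m m n) q) d)
  (□ₙ-lower (≤⇒≤′ (m≤n⊔m m n)) Y q _))

reindex : ∀ m n X .(p : m exceeds X) .(q : n exceeds X) → GLₕ (□ₙ m X p ⇒ □ₙ n X q)
reindex m n X p q = GLₕ-□-mono m n p q (GLₕ-refl X)

-- `Kₕ` asks for one index on all three boxes. The index `k` of the implication is admissible for
-- both sides, so `Kₕ` is used there and the other two boxes are reindexed.
reindexed-K : ∀ k m n X Y .(p : k exceeds (X ⇒ Y)) .(q : m exceeds X) .(r : n exceeds Y) →
              GLₕ (□ₙ k (X ⇒ Y) p ⇒ (□ₙ m X q ⇒ □ₙ n Y r))
reindexed-K k m n X Y p q r = GLₕ-trans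
  (Kₕ k X Y p (++⁻ˡ (indices X) p) (++⁻ʳ (indices X) p))
  (GLₕ-⇒-mono (reindex m k X q _) (reindex k n Y _ r))

-- `Lₕ` insists on `suc n` outside; with `m` arbitrary this applies to whatever level `lift` puts
-- there.
reindexed-L : ∀ m n X .(p : n exceeds X) .(q : m exceeds (□ₙ n X p ⇒ X)) →
              GLₕ (□ₙ m (□ₙ n X p ⇒ X) q ⇒ □ₙ n X p)
reindexed-L m n X p q = GLₕ-trans
  (reindex m (suc n) (□ₙ n X p ⇒ X) q
    (exceeds-reflection n X p (exceeds-mono X (n≤1+n n) p)))
  (Lₕ n X p _)

-- Least admissible indices

-- For a box-free `X` the default 0 gives level 1, one above the least admissible index; otherwise
-- the level is least.
level : Form∞ → ℕ
level X = suc (max 0 (indices X))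

level-exceeds : ∀ X → level X exceeds X
level-exceeds X = All.map s≤s (xs≤max 0 (indices X))

-- The index of a box depends only on its body, so a subformula has the same lift wherever it
-- occurs. Hence tautologies and modus ponens carry over literally.
lift : Form□ → Form∞
lift (atom p) = atom p
lift ⊥        = ⊥
lift ⊤        = ⊤
lift (∼ A)    = ∼ lift A
lift (A ∧ B)  = lift A ∧ lift B
lift (A ∨ B)  = lift A ∨ lift B
lift (A ⇒ B)  = lift A ⇒ lift B
lift (□ A)    = □ₙ (level (lift A)) (lift A) (level-exceeds (lift A))

eval-lift : ∀ v A → eval∞ v (lift A) ≡ eval□ (v ∘ lift) A
eval-lift v (atom p) = refl
eval-lift v ⊥        = refl
eval-lift v ⊤        = refl
eval-lift v (∼ A)    = cong not (eval-lift v A)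
eval-lift v (A ∧ B)  = cong₂ Bool._∧_ (eval-lift v A) (eval-lift v B)
eval-lift v (A ∨ B)  = cong₂ Bool._∨_ (eval-lift v A) (eval-lift v B)
eval-lift v (A ⇒ B)  = cong₂ _⊃_ (eval-lift v A) (eval-lift v B)
eval-lift v (□ A)    = refl

GL⇒GLₕ-lift : GL A → GLₕ (lift A)
GL⇒GLₕ-lift {A} (taut t) = taut λ v → trans (eval-lift v A) (t (v ∘ lift))
GL⇒GLₕ-lift (K A B)  = reindexed-K _ _ _ (lift A) (lift B) _ _ _
GL⇒GLₕ-lift (L A)    = reindexed-L _ _ (lift A) _ _
GL⇒GLₕ-lift (mp d e) = mp (GL⇒GLₕ-lift d) (GL⇒GLₕ-lift e)
GL⇒GLₕ-lift (nec d)  = nec _ _ (GL⇒GLₕ-lift d)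

mutual
  -- The two directions are proved together because negations and antecedents swap them. At a box,
  -- index and body change in one step.
  toLift : ∀ X → GLₕ (X ⇒ lift (X ᶠ))
  toLift (atom p)   = GLₕ-refl (atom p)
  toLift ⊥          = GLₕ-refl ⊥
  toLift ⊤          = GLₕ-refl ⊤
  toLift (∼ X)      = GLₕ-∼-mono (fromLift X)
  toLift (X ∧ Y)    = GLₕ-∧-mono (toLift X) (toLift Y)
  toLift (X ∨ Y)    = GLₕ-∨-mono (toLift X) (toLift Y)
  toLift (X ⇒ Y)    = GLₕ-⇒-mono (fromLift X) (toLift Y)
  toLift (□ₙ n X p) = GLₕ-□-mono n _ p _ (toLift X)

  fromLift : ∀ X → GLₕ (lift (X ᶠ) ⇒ X)
  fromLift (atom p)   = GLₕ-refl (atom p)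
  fromLift ⊥          = GLₕ-refl ⊥
  fromLift ⊤          = GLₕ-refl ⊤
  fromLift (∼ X)      = GLₕ-∼-mono (toLift X)
  fromLift (X ∧ Y)    = GLₕ-∧-mono (fromLift X) (fromLift Y)
  fromLift (X ∨ Y)    = GLₕ-∨-mono (fromLift X) (fromLift Y)
  fromLift (X ⇒ Y)    = GLₕ-⇒-mono (toLift X) (fromLift Y)
  fromLift (□ₙ n X p) = GLₕ-□-mono _ n _ p (fromLift X)

GL⇒GLₕ : ∀ X → GL (X ᶠ) → GLₕ X
GL⇒GLₕ X d = mp (fromLift X) (GL⇒GLₕ-lift d)

-- Witnesses and sets of premises

⟨⟩-ᶠ : ∀ A (w : Witness A) → (A ⟨ w ⟩) ᶠ ≡ A
⟨⟩-ᶠ (atom p) w = refl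
⟨⟩-ᶠ ⊥        w = refl
⟨⟩-ᶠ ⊤        w = refl
⟨⟩-ᶠ (∼ A)    w = cong ∼_ (⟨⟩-ᶠ A _)
⟨⟩-ᶠ (A ∧ B)  w = cong₂ _∧_ (⟨⟩-ᶠ A _) (⟨⟩-ᶠ B _)
⟨⟩-ᶠ (A ∨ B)  w = cong₂ _∨_ (⟨⟩-ᶠ A _) (⟨⟩-ᶠ B _)
⟨⟩-ᶠ (A ⇒ B)  w = cong₂ _⇒_ (⟨⟩-ᶠ A _) (⟨⟩-ᶠ B _)
⟨⟩-ᶠ (□ A)    w = cong □_ (⟨⟩-ᶠ A _)

All-ᶠˢ : ∀ {ℓ} {Γ : Pred Form∞ ℓ} {Δ} → All (_∈ Γ) Δ → All (_∈ Γ ᶠˢ) (map _ᶠ Δ)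
All-ᶠˢ []         = []
All-ᶠˢ (X∈Γ ∷ ps) = (_ , X∈Γ , refl) ∷ All-ᶠˢ ps

instantiate : ∀ {ℓ} {Γ : Pred Form□ ℓ} (v : Witnessˢ Γ) {Δ} → All (_∈ Γ) Δ →
              ∃[ Δ′ ] (All (_∈ Γ ⟨ v ⟩ˢ) Δ′ × (⋀∞ Δ′) ᶠ ≡ ⋀□ Δ)
instantiate v []               = [] , [] , refl
instantiate v (_∷_ {B} B∈Γ ps) =
  let Δ′ , qs , eq = instantiate v ps
  in  B ⟨ v B B∈Γ ⟩ ∷ Δ′ , (B , B∈Γ , refl) ∷ qs , cong₂ _∧_ (⟨⟩-ᶠ B _) eq

theorem3p13 : ∀ {ℓ : Level} →
    ((Γ : Pred Form∞ ℓ) (A : Form∞) →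
    Γ ⊢∞[ GLₕ ] A → Γ ᶠˢ ⊢□[ GL ] A ᶠ)
    ×
    ((Γ : Pred Form□ ℓ) (A : Form□) (v : Witnessˢ Γ) (w : Witness A) →
    Γ ⊢□[ GL ] A → Γ ⟨ v ⟩ˢ ⊢∞[ GLₕ ] A ⟨ w ⟩)
theorem3p13 =
  (λ Γ A (Δ , Δ⊆Γ , d) →
    map _ᶠ Δ , All-ᶠˢ Δ⊆Γ , subst (λ C → GL (C ⇒ A ᶠ)) (⋀-ᶠ Δ) (GLₕ⇒GL d)) ,
  (λ Γ A v w (Δ , Δ⊆Γ , d) →
    let Δ′ , Δ′⊆Γv , eq = instantiate v Δ⊆Γ
    in  Δ′ , Δ′⊆Γv ,
        -- The implication is transferred as a whole: its forgetful image is the given GL-theorem.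
        GL⇒GLₕ (⋀∞ Δ′ ⇒ A ⟨ w ⟩) (subst GL (sym (cong₂ _⇒_ eq (⟨⟩-ᶠ A w))) d))
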